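{- Let $G$ be a finite simple graph of maximum degree $6$. Then $\chi^t_{\mathrm P}(G)\le 2$; that is, there is a map $\ell: V(G)\cup E(G)\to\{1,2\}$ such that for every edge $uv$ of $G$ we have $\pi_\ell(u)\neq\pi_\ell(v)$, where $\pi_\ell(w)=\ell(w)\cdot\prod_{x\in N(w)}\ell(wx)$.
   Context: A total $k$-labelling of a graph $G$ is a map $\ell: V(G)\cup E(G)\to\{1,\dots,k\}$. For a vertex $w$, $\pi_\ell(w)$ denotes the product of the label of $w$ and the labels of all edges incident to $w$. The labelling is product-proper if $\pi_\ell(u)\ne\pi_\ell(v)$ for every edge $uv$. $\chi^t_{\mathrm P}(G)$ is the smallest $k\ge1$ such that $G$ admits a product-proper total $k$-labelling. -}

module Defs where

open import Data.Nat using (ℕ; _*_; _≤_)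
open import Data.Bool using (Bool; true; false; if_then_else_)
open import Data.Fin using (Fin)
open import Data.List using (List; filter; length; map; allFin)
open import Data.Nat.ListAction using (product)
open import Data.Product using (_×_; ∃)
open import Relation.Binary.PropositionalEquality using (_≡_; _≢_)
open import Data.Bool using (T)

record Graph (n : ℕ) : Set where
  field
    adj   : Fin n → Fin n → Bool
    sym   : ∀ u v → adj u v ≡ adj v u
    irrefl : ∀ v → adj v v ≡ false
open Graph public

nbrs : ∀ {n} → Graph n → Fin n → List (Fin n)
nbrs {n} G v = filter (λ w → Data.Bool._≟_ (adj G v w) true) (allFin n)

degree : ∀ {n} → Graph n → Fin n → ℕ
degree G v = length (nbrs G v)

MaxDegree : ∀ {n} → Graph n → ℕ → Set
MaxDegree {n} G d = (∀ v → degree G v ≤ d) × ∃ (λ (v : Fin n) → degree G v ≡ d)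

-- A total labelling: a vertex labelling and an edge labelling. Edge labels
-- are given as a function on ordered pairs which must be symmetric on edges
-- (so it is a function on the unordered edges uv).
record TotalLabelling (n : ℕ) : Set where
  field
    vlab : Fin n → ℕ
    elab : Fin n → Fin n → ℕ
open TotalLabelling public

InRange : ℕ → ℕ → Set
InRange k x = 1 ≤ x × x ≤ k

IsTotalLabelling : ∀ {n} → Graph n → ℕ → TotalLabelling n → Set
IsTotalLabelling G k ℓ =
  (∀ v → InRange k (vlab ℓ v)) ×
  (∀ u v → T (adj G u v) → InRange k (elab ℓ u v) × elab ℓ u v ≡ elab ℓ v u)

π : ∀ {n} → Graph n → TotalLabelling n → Fin n → ℕ
π G ℓ w = vlab ℓ w * product (map (elab ℓ w) (nbrs G w))

ProductProper : ∀ {n} → Graph n → TotalLabelling n → Set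
ProductProper G ℓ = ∀ u v → T (adj G u v) → π G ℓ u ≢ π G ℓ v

{-# OPTIONS --safe #-}

-- With labels 1 and 2, π(w) = 2 ^ (x + deg_H w), where H consists of the edges labelled 2 and
-- x ∈ {0,1} records the label of w. So it suffices to find a proper colouring r and a graph H
-- with deg_H w ∈ {r w - 1, r w} for every w.
--
-- Peel off maximum independent sets V₀, V₁, V₂, … and let r be the index of the layer. Every
-- vertex has a neighbour in each lower layer, and an exchange argument matches every independent
-- set above Vᵢ into Vᵢ. Let D v be the number of neighbours of v in V₃ ∪ V₄ ∪ …; for r v ≥ 3 we
-- have D v ≤ 3, since three of the at most six neighbours lie in V₀, V₁, V₂. Put
-- E v = D v + 3 - r v, which bounds the number of neighbours of v in higher layers.
--
-- H contains all edges inside V₃ ∪ V₄ ∪ … and none at V₀, so a vertex v with r v ≥ 3 needs 2 - E v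
-- or 3 - E v edges of H into V₁ ∪ V₂. The vertices with E v ≤ 1 induce a forest, hence split
-- into two independent sets, and the two matchings into V₂ give each of them one edge while using
-- no vertex of V₂ more than twice. Next, each vertex of V₂ still without an edge receives one
-- from a neighbour with room for it, if there is one. The vertices of V₂ left without an edge,
-- together with those above that still lack one edge, form an independent set; match it into V₁.

module Submission where

open import Defs renaming (sym to adj-sym; irrefl to adj-irrefl)
open import Data.Bool using (Bool; true; false; T; if_then_else_; _∧_; _∨_; not)
open import Data.Bool.Properties using (not-¬; ¬-not; not-injective; ∨-comm; ∧-comm)
open import Data.Empty using (⊥; ⊥-elim)
open import Data.Fin using (Fin; zero; suc; toℕ; _≟_)
open import Data.Fin.Properties using (any?; all?; suc-injective; toℕ<n; toℕ-injective)
open import Data.List as List using (List; []; _∷_; allFin; filter; length; map)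
open import Data.List.Membership.Propositional.Properties using (∈-allFin)
open import Data.List.Relation.Unary.All as All using (All; []; _∷_)
open import Data.Nat using (ℕ; zero; suc; _+_; _*_; _∸_; _^_; _≤_; _<_; _≤?_; z≤n; s≤s)
import Data.Nat as ℕ
open import Data.Nat.ListAction using (product)
open import Data.Nat.Solver using (module +-*-Solver)
open import Data.Nat.Properties hiding (_≟_; suc-injective)
open import Data.Product using (∃; _×_; _,_; proj₁; proj₂)
open import Data.Sum using (_⊎_; inj₁; inj₂)
open import Data.Vec using (Vec; []; _∷_; lookup; tabulate)
open import Data.Vec.Properties using (lookup∘tabulate)
open import Function using (_∘_; id; case_of_)
open import Relation.Binary using (tri<; tri≈; tri>)
open import Relation.Binary.PropositionalEquality
  using (_≡_; _≢_; refl; sym; trans; cong; cong₂; subst; module ≡-Reasoning)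
open import Relation.Nullary using (¬_; Dec; yes; no; does)
open import Relation.Nullary.Decidable using (dec-true; dec-false; _×-dec_; _⊎-dec_; _→-dec_; ¬?)

-- Finite sets and their sizes

Sub : ℕ → Set
Sub n = Fin n → Bool

private variable
  k n : ℕ
  A B : Set

infix 4 _∈_ _∉_ _⊆_
infixl 6 _∪_ _∖_ _∩_

_∈_ _∉_ : Fin n → Sub n → Set
x ∈ P = P x ≡ true
x ∉ P = ¬ (x ∈ P)

_⊆_ : Sub n → Sub n → Set
P ⊆ Q = ∀ {x} → x ∈ P → x ∈ Q

_∪_ _∩_ _∖_ : Sub n → Sub n → Sub n
(P ∪ Q) x = P x ∨ Q x
(P ∩ Q) x = P x ∧ Q x
(P ∖ Q) x = P x ∧ not (Q x)

⁅_⁆ : Fin n → Sub n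
⁅ x ⁆ y = does (y ≟ x)

does⁻ : (d : Dec A) → does d ≡ true → A
does⁻ (yes a) _ = a

∧⁻ : ∀ {a b} → a ∧ b ≡ true → a ≡ true × b ≡ true
∧⁻ {true} {true} _ = refl , refl

∧⁺ : ∀ {a b} → a ≡ true → b ≡ true → a ∧ b ≡ true
∧⁺ refl refl = refl

∨⁻ : ∀ {a b} → a ∨ b ≡ true → a ≡ true ⊎ b ≡ true
∨⁻ {true}  _ = inj₁ refl
∨⁻ {false} e = inj₂ e

∨⁺ˡ : ∀ {a b} → a ≡ true → a ∨ b ≡ true
∨⁺ˡ refl = refl

∨⁺ʳ : ∀ {a b} → b ≡ true → a ∨ b ≡ true
∨⁺ʳ {true}  _ = refl
∨⁺ʳ {false} e = e

not⁻ : ∀ {b} → not b ≡ true → ¬ (b ≡ true)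
not⁻ {false} _ ()

not⁺ : ∀ {b} → ¬ (b ≡ true) → not b ≡ true
not⁺ {true}  h = ⊥-elim (h refl)
not⁺ {false} _ = refl

⇔⇒≡ : ∀ {a b} → (a ≡ true → b ≡ true) → (b ≡ true → a ≡ true) → a ≡ b
⇔⇒≡ {true}          f g = sym (f refl)
⇔⇒≡ {false} {true}  f g = g refl
⇔⇒≡ {false} {false} f g = refl

_∈?_ : (x : Fin n) (P : Sub n) → Dec (x ∈ P)
x ∈? P = P x Data.Bool.≟ true

∈⁅⁆ : (x : Fin n) → x ∈ ⁅ x ⁆
∈⁅⁆ x = dec-true (x ≟ x) refl

∈⁅⁆⁻ : {x y : Fin n} → y ∈ ⁅ x ⁆ → y ≡ x
∈⁅⁆⁻ {x = x} {y} = does⁻ (y ≟ x)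

∈∖⁅⁆ : {x y : Fin n} {P : Sub n} → y ∈ P → y ≢ x → y ∈ P ∖ ⁅ x ⁆
∈∖⁅⁆ y∈P y≢x = ∧⁺ y∈P (not⁺ (y≢x ∘ ∈⁅⁆⁻))

∖⁅⁆⁻ : {x y : Fin n} {P : Sub n} → y ∈ P ∖ ⁅ x ⁆ → y ∈ P × y ≢ x
∖⁅⁆⁻ {x = x} {y} {P} e with ∧⁻ {P y} e
... | y∈P , y∉x = y∈P , not⁻ y∉x ∘ dec-true (y ≟ x)

𝟙 : Bool → ℕ
𝟙 b = if b then 1 else 0

𝟙≤1 : ∀ b → 𝟙 b ≤ 1
𝟙≤1 true  = ≤-refl
𝟙≤1 false = z≤n

# : Sub n → ℕ
# {zero}  P = 0
# {suc n} P = 𝟙 (P zero) + # (P ∘ suc)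

#-mono : {P Q : Sub n} → P ⊆ Q → # P ≤ # Q
#-mono {zero}          P⊆Q = z≤n
#-mono {suc n} {P} {Q} P⊆Q = +-mono-≤ head (#-mono (λ {x} → P⊆Q {suc x}))
  where
  head : 𝟙 (P zero) ≤ 𝟙 (Q zero)
  head with P zero in p
  ... | false = z≤n
  ... | true rewrite P⊆Q p = ≤-refl

#-cong : {P Q : Sub n} → (∀ x → P x ≡ Q x) → # P ≡ # Q
#-cong P≗Q = ≤-antisym (#-mono (λ {x} → trans (sym (P≗Q x)))) (#-mono (λ {x} → trans (P≗Q x)))

#-∅ : {P : Sub n} → (∀ x → x ∉ P) → # P ≡ 0
#-∅ {zero}      h = refl
#-∅ {suc n} {P} h with P zero in p
... | true  = ⊥-elim (h zero p)
... | false = #-∅ (h ∘ suc)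

#-∪ : (P Q : Sub n) → (∀ {x} → x ∈ P → x ∉ Q) → # (P ∪ Q) ≡ # P + # Q
#-∪ {zero}  P Q dis = refl
#-∪ {suc n} P Q dis = begin
  𝟙 (P zero ∨ Q zero) + # ((P ∪ Q) ∘ suc)                ≡⟨ cong₂ _+_ head (#-∪ (P ∘ suc) (Q ∘ suc) dis) ⟩
  (𝟙 (P zero) + 𝟙 (Q zero)) + (# (P ∘ suc) + # (Q ∘ suc)) ≡⟨ +-assoc (𝟙 (P zero)) _ _ ⟩
  𝟙 (P zero) + (𝟙 (Q zero) + (# (P ∘ suc) + # (Q ∘ suc))) ≡⟨ cong (𝟙 (P zero) +_) (swap (𝟙 (Q zero)) (# (P ∘ suc)) _) ⟩
  𝟙 (P zero) + (# (P ∘ suc) + (𝟙 (Q zero) + # (Q ∘ suc))) ≡⟨ sym (+-assoc (𝟙 (P zero)) _ _) ⟩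
  # P + # Q                                               ∎
  where
  open ≡-Reasoning
  swap : ∀ a b c → a + (b + c) ≡ b + (a + c)
  swap a b c = trans (sym (+-assoc a b c)) (trans (cong (_+ c) (+-comm a b)) (+-assoc b a c))
  head : 𝟙 (P zero ∨ Q zero) ≡ 𝟙 (P zero) + 𝟙 (Q zero)
  head with P zero in p | Q zero in q
  ... | true  | true  = ⊥-elim (dis p q)
  ... | true  | false = refl
  ... | false | _     = refl

#-split : (P Q : Sub n) → # P ≡ # (P ∩ Q) + # (P ∖ Q)
#-split P Q = trans (#-cong λ x → cases (P x) (Q x))
                    (#-∪ (P ∩ Q) (P ∖ Q) λ {x} x∈ x∈′ → not⁻ (proj₂ (∧⁻ {P x} x∈′)) (proj₂ (∧⁻ {P x} x∈)))
  where
  cases : ∀ a b → a ≡ (a ∧ b) ∨ (a ∧ not b)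
  cases true  true  = refl
  cases true  false = refl
  cases false _     = refl

#-⁅⁆ : (x : Fin n) → # ⁅ x ⁆ ≡ 1
#-⁅⁆ {suc n} zero    = cong suc (#-∅ {n} λ _ ())
#-⁅⁆ {suc n} (suc x) = trans (#-cong {n} (λ y → ⇔⇒≡ (λ e → dec-true (y ≟ x) (suc-injective (does⁻ (suc y ≟ suc x) e)))
                                                      (λ e → dec-true (suc y ≟ suc x) (cong suc (does⁻ (y ≟ x) e)))))
                             (#-⁅⁆ x)

#-remove : {x : Fin n} {P : Sub n} → x ∈ P → # P ≡ suc (# (P ∖ ⁅ x ⁆))
#-remove {x = x} {P} x∈P = begin
  # P                         ≡⟨ #-cong (λ y → ⇔⇒≡ (split y) (join y)) ⟩
  # (⁅ x ⁆ ∪ (P ∖ ⁅ x ⁆))       ≡⟨ #-∪ ⁅ x ⁆ (P ∖ ⁅ x ⁆) (λ e e′ → proj₂ (∖⁅⁆⁻ {P = P} e′) (∈⁅⁆⁻ e)) ⟩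
  # ⁅ x ⁆ + # (P ∖ ⁅ x ⁆)       ≡⟨ cong (_+ # (P ∖ ⁅ x ⁆)) (#-⁅⁆ x) ⟩
  suc (# (P ∖ ⁅ x ⁆))          ∎
  where
  open ≡-Reasoning
  split : ∀ y → y ∈ P → y ∈ ⁅ x ⁆ ∪ (P ∖ ⁅ x ⁆)
  split y y∈P with y ≟ x
  ... | yes _  = refl
  ... | no y≢x = ∧⁺ y∈P refl
  join : ∀ y → y ∈ ⁅ x ⁆ ∪ (P ∖ ⁅ x ⁆) → y ∈ P
  join y e with ∨⁻ {⁅ x ⁆ y} e
  ... | inj₁ y∈x = subst (_∈ P) (sym (∈⁅⁆⁻ y∈x)) x∈P
  ... | inj₂ e′ = proj₁ (∖⁅⁆⁻ {P = P} e′)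

#-pos : {x : Fin n} {P : Sub n} → x ∈ P → 1 ≤ # P
#-pos {x = x} {P} x∈P = subst (1 ≤_) (sym (#-remove {P = P} x∈P)) (s≤s z≤n)

#-strict : {x : Fin n} {P Q : Sub n} → P ⊆ Q → x ∈ Q → x ∉ P → # P < # Q
#-strict {x = x} {P} {Q} P⊆Q x∈Q x∉P = subst (# P <_) (sym (#-remove {P = Q} x∈Q))
  (s≤s (#-mono {P = P} (λ y∈P → ∈∖⁅⁆ {P = Q} (P⊆Q y∈P) λ { refl → x∉P y∈P })))

#-inj : (f : Fin k → Fin n) {P : Sub k} {Q : Sub n} → (∀ {x} → x ∈ P → f x ∈ Q) →
        (∀ {x y} → x ∈ P → y ∈ P → f x ≡ f y → x ≡ y) → # P ≤ # Q
#-inj {zero}  f into inj = z≤n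
#-inj {suc k} f {P} {Q} into inj with P zero in p
... | false = #-inj (f ∘ suc) into (λ a b e → suc-injective (inj a b e))
... | true  = subst (suc (# (P ∘ suc)) ≤_) (sym (#-remove {P = Q} (into p)))
  (s≤s (#-inj (f ∘ suc) (λ a → ∈∖⁅⁆ {P = Q} (into a) λ e → case inj a p e of λ ())
                        (λ a b e → suc-injective (inj a b e))))

#-full : ∀ k → # {k} (λ _ → true) ≡ k
#-full zero    = refl
#-full (suc k) = cong suc (#-full k)

#-≤1 : {P : Sub n} → (∀ {x y} → x ∈ P → y ∈ P → x ≡ y) → # P ≤ 1
#-≤1 {P = P} h = #-inj {n = 1} (λ _ → zero) {P} {λ _ → true} (λ _ → refl) (λ a b _ → h a b)

-- Recursion on `Vec` gives an exhaustive search over all subsets; `maximumIndependent` reads the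
-- optimum back with `lookup`.
argmax : (f : Vec Bool n → ℕ) → ∃ λ s → ∀ t → f t ≤ f s
argmax {zero}  f = [] , λ { [] → ≤-refl }
argmax {suc n} f with argmax (f ∘ (true ∷_)) | argmax (f ∘ (false ∷_))
... | s , s-max | t , t-max with ≤-total (f (true ∷ s)) (f (false ∷ t))
... | inj₁ s≤t = false ∷ t , λ { (true ∷ u) → ≤-trans (s-max u) s≤t ; (false ∷ u) → t-max u }
... | inj₂ t≤s = true ∷ s , λ { (true ∷ u) → s-max u ; (false ∷ u) → ≤-trans (t-max u) t≤s }

-- Lets `augment` stop at the first neighbour that allows an augmentation, or else gather an
-- obstruction for every neighbour.
distrib-⊎-∀ : {B : Fin n → Set} → (∀ i → A ⊎ B i) → A ⊎ (∀ i → B i)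
distrib-⊎-∀ {zero}  f = inj₂ λ ()
distrib-⊎-∀ {suc n} f with f zero | distrib-⊎-∀ (f ∘ suc)
... | inj₁ a | _      = inj₁ a
... | inj₂ _ | inj₁ a = inj₁ a
... | inj₂ b | inj₂ g = inj₂ λ { zero → b ; (suc i) → g i }

module _ {n : ℕ} (G : Graph n) where

  infix 4 _~_

  _~_ : Fin n → Fin n → Set
  u ~ v = adj G u v ≡ true

  _~?_ : ∀ u v → Dec (u ~ v)
  u ~? v = adj G u v Data.Bool.≟ true

  ~-sym : ∀ {u v} → u ~ v → v ~ u
  ~-sym {u} {v} = trans (adj-sym G v u)

  ~-irrefl : ∀ {v} → ¬ (v ~ v)
  ~-irrefl {v} v~v with () ← trans (sym v~v) (adj-irrefl G v)

  Independent : Sub n → Set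
  Independent P = ∀ {u v} → u ∈ P → v ∈ P → ¬ (u ~ v)

  -- Matchings into a maximum independent set

  record Matching (I W : Sub n) : Set where
    field
      to   : Fin n → Fin n
      edge : ∀ {x} → x ∈ I → x ~ to x
      into : ∀ {x} → x ∈ I → to x ∈ W
      inj  : ∀ {x y} → x ∈ I → y ∈ I → to x ≡ to y → x ≡ y

  open Matching

  restrict : ∀ {I I′ W W′} → I′ ⊆ I → W ⊆ W′ → Matching I W → Matching I′ W′
  restrict I′⊆I W⊆W′ M .to         = M .to
  restrict I′⊆I W⊆W′ M .edge x∈    = M .edge (I′⊆I x∈)
  restrict I′⊆I W⊆W′ M .into x∈    = W⊆W′ (M .into (I′⊆I x∈))
  restrict I′⊆I W⊆W′ M .inj  x∈ y∈ = M .inj (I′⊆I x∈) (I′⊆I y∈)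

  extend : ∀ {I W x w} → Matching I (W ∖ ⁅ w ⁆) → x ~ w → w ∈ W → Matching (I ∪ ⁅ x ⁆) W
  extend {I} {W} {x} {w} M x~w w∈W = record { to = f ; edge = f-edge ; into = f-into ; inj = f-inj }
    where
    f : Fin n → Fin n
    f z = if does (z ≟ x) then w else M .to z
    old : ∀ {z} → z ∈ I ∪ ⁅ x ⁆ → z ≢ x → z ∈ I
    old {z} z∈ z≢x with ∨⁻ {I z} z∈
    ... | inj₁ z∈I = z∈I
    ... | inj₂ z∈x = ⊥-elim (z≢x (∈⁅⁆⁻ z∈x))
    M-into : ∀ {z} → z ∈ I → M .to z ∈ W × M .to z ≢ w
    M-into z∈I = ∖⁅⁆⁻ {P = W} (M .into z∈I)
    f-edge : ∀ {z} → z ∈ I ∪ ⁅ x ⁆ → z ~ f z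
    f-edge {z} z∈ with z ≟ x | old {z} z∈
    ... | yes refl | _     = x~w
    ... | no z≢x   | z∈I = M .edge (z∈I z≢x)
    f-into : ∀ {z} → z ∈ I ∪ ⁅ x ⁆ → f z ∈ W
    f-into {z} z∈ with z ≟ x | old {z} z∈
    ... | yes refl | _     = w∈W
    ... | no z≢x   | z∈I = proj₁ (M-into (z∈I z≢x))
    f-inj : ∀ {y z} → y ∈ I ∪ ⁅ x ⁆ → z ∈ I ∪ ⁅ x ⁆ → f y ≡ f z → y ≡ z
    f-inj {y} {z} y∈ z∈ e with y ≟ x | z ≟ x | old {y} y∈ | old {z} z∈
    ... | yes y≡x | yes z≡x | _   | _   = trans y≡x (sym z≡x)
    ... | yes _   | no z≢x  | _   | z∈I = ⊥-elim (proj₂ (M-into (z∈I z≢x)) (sym e))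
    ... | no y≢x  | yes _   | y∈I | _   = ⊥-elim (proj₂ (M-into (y∈I y≢x)) e)
    ... | no y≢x  | no z≢x  | y∈I | z∈I = M .inj (y∈I y≢x) (z∈I z≢x) e

  -- A Hall-type obstruction: if `x` and all of `Y` are trapped, their neighbours in `W` lie in the
  -- image of `Y` under `f`, so `# Y + 1` vertices outside share at most `# Y` partners.
  Trapped : (Fin n → Fin n) → Sub n → Sub n → Fin n → Set
  Trapped f W Y z = ∀ {w} → w ∈ W → z ~ w → ∃ λ y → y ∈ Y × f y ≡ w

  -- Search for an alternating path from x; when there is none, the vertices of I met on the
  -- way form the set Y.
  augment : ∀ k {I W} (M : Matching I W) x → # I ≤ k →
            Matching (I ∪ ⁅ x ⁆) W ⊎
            (∃ λ Y → Y ⊆ I × (∀ {z} → z ∈ Y → Trapped (M .to) W Y z) × Trapped (M .to) W Y x)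
  augment k {I} {W} M x #I≤k with distrib-⊎-∀ step
    where
    Blocked : Fin n → Sub n → Set
    Blocked w Y = Y ⊆ I × (∀ {z} → z ∈ Y → Trapped (M .to) W Y z) ×
                  (w ∈ W → x ~ w → ∃ λ y → y ∈ Y × M .to y ≡ w)
    recurse : ∀ k w x′ → # I ≤ k → w ∈ W → x ~ w → x′ ∈ I → M .to x′ ≡ w →
              Matching (I ∪ ⁅ x ⁆) W ⊎ ∃ (Blocked w)
    recurse zero    w x′ #I≤k w∈W x~w x′∈I x′↦w with () ← ≤-trans (#-pos {P = I} x′∈I) #I≤k
    -- `x` takes `w` from `x′`, and `x′` seeks a new partner after `x′` and `w` are deleted. If it
    -- finds none, `x′` joins the obstruction, where it accounts for `w`.
    recurse (suc k) w x′ #I≤k w∈W x~w x′∈I x′↦w = case augment k M′ x′ smaller of λ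
      { (inj₁ M″) → inj₁ (restrict shrink id (extend M″ x~w w∈W))
      ; (inj₂ (Y , Y⊆ , trap , trap′)) → inj₂ (Y ∪ ⁅ x′ ⁆ , (λ {_} → sub Y Y⊆) , (λ {_} → grow Y trap trap′) ,
          λ _ _ → x′ , ∨⁺ʳ (∈⁅⁆ x′) , x′↦w) }
      where
      smaller : # (I ∖ ⁅ x′ ⁆) ≤ k
      smaller = ≤-pred (subst (_≤ suc k) (#-remove {P = I} x′∈I) #I≤k)
      M′ : Matching (I ∖ ⁅ x′ ⁆) (W ∖ ⁅ w ⁆)
      M′ .to = M .to
      M′ .edge z∈ = M .edge (proj₁ (∖⁅⁆⁻ {P = I} z∈))
      M′ .into z∈ = case ∖⁅⁆⁻ {P = I} z∈ of λ { (z∈I , z≢x′) →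
        ∈∖⁅⁆ {P = W} (M .into z∈I) λ e → z≢x′ (M .inj z∈I x′∈I (trans e (sym x′↦w))) }
      M′ .inj y∈ z∈ = M .inj (proj₁ (∖⁅⁆⁻ {P = I} y∈)) (proj₁ (∖⁅⁆⁻ {P = I} z∈))
      shrink : I ∪ ⁅ x ⁆ ⊆ (I ∖ ⁅ x′ ⁆) ∪ ⁅ x′ ⁆ ∪ ⁅ x ⁆
      shrink {z} z∈ with ∨⁻ {I z} z∈ | z ≟ x′
      ... | inj₂ z∈x | _      = ∨⁺ʳ z∈x
      ... | inj₁ z∈I | yes _  = ∨⁺ˡ (∨⁺ʳ {I z ∧ false} refl)
      ... | inj₁ z∈I | no _ = ∨⁺ˡ (∨⁺ˡ (∧⁺ z∈I refl))
      sub : ∀ Y → Y ⊆ I ∖ ⁅ x′ ⁆ → Y ∪ ⁅ x′ ⁆ ⊆ I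
      sub Y Y⊆ {z} z∈ with ∨⁻ {Y z} z∈
      ... | inj₁ z∈Y  = proj₁ (∖⁅⁆⁻ {P = I} (Y⊆ z∈Y))
      ... | inj₂ z∈x′ = subst (_∈ I) (sym (∈⁅⁆⁻ z∈x′)) x′∈I
      grow : ∀ Y → (∀ {z} → z ∈ Y → Trapped (M .to) (W ∖ ⁅ w ⁆) Y z) →
             Trapped (M .to) (W ∖ ⁅ w ⁆) Y x′ →
             ∀ {z} → z ∈ Y ∪ ⁅ x′ ⁆ → Trapped (M .to) W (Y ∪ ⁅ x′ ⁆) z
      grow Y trap trap′ {z} z∈ {v} v∈W z~v with v ≟ w
      ... | yes v≡w = x′ , ∨⁺ʳ (∈⁅⁆ x′) , trans x′↦w (sym v≡w)
      ... | no v≢w with ∨⁻ {Y z} z∈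
      ...   | inj₁ z∈Y  = case trap z∈Y (∈∖⁅⁆ {P = W} v∈W v≢w) z~v of λ { (y , y∈Y , e) → y , ∨⁺ˡ y∈Y , e }
      ...   | inj₂ z∈x′ = case trap′ (∈∖⁅⁆ {P = W} v∈W v≢w) (subst (_~ v) (∈⁅⁆⁻ z∈x′) z~v) of λ
                            { (y , y∈Y , e) → y , ∨⁺ˡ y∈Y , e }
    step : ∀ w → Matching (I ∪ ⁅ x ⁆) W ⊎ ∃ (Blocked w)
    step w with w ∈? W | x ~? w
    ... | no w∉W | _     = inj₂ ((λ _ → false) , (λ ()) , (λ ()) , λ w∈W → ⊥-elim (w∉W w∈W))
    ... | _     | no x≁w = inj₂ ((λ _ → false) , (λ ()) , (λ ()) , λ _ x~w → ⊥-elim (x≁w x~w))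
    ... | yes w∈W | yes x~w with any? (λ z → (z ∈? I) ×-dec (M .to z ≟ w))
    ...   | yes (x′ , x′∈I , x′↦w) = recurse k w x′ #I≤k w∈W x~w x′∈I x′↦w
    ...   | no free = inj₁ (extend (record { to = M .to ; edge = M .edge ; inj = M .inj
                        ; into = λ z∈I → ∈∖⁅⁆ {P = W} (M .into z∈I) λ e → free (_ , z∈I , e) }) x~w w∈W)
  ... | inj₁ M′ = inj₁ M′
  ... | inj₂ blocked = inj₂ (Y , (λ {_} → Y⊆I) , (λ {_} → trapped) , λ {w} w∈W x~w →
          case proj₂ (proj₂ (proj₂ (blocked w))) w∈W x~w of λ { (y , y∈Yw , e) → y , Y⁺ w y∈Yw , e })
    where
    -- `Trapped` is monotone in its set, so the obstructions found for the single neighbours combine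
    -- to their union.
    Y : Sub n
    Y z = does (any? λ w → z ∈? proj₁ (blocked w))
    Y⁺ : ∀ w {z} → z ∈ proj₁ (blocked w) → z ∈ Y
    Y⁺ w z∈ = dec-true (any? _) (w , z∈)
    Y⁻ : ∀ {z} → z ∈ Y → ∃ λ w → z ∈ proj₁ (blocked w)
    Y⁻ = does⁻ (any? _)
    Y⊆I : Y ⊆ I
    Y⊆I z∈ = case Y⁻ z∈ of λ { (w , z∈Yw) → proj₁ (proj₂ (blocked w)) z∈Yw }
    trapped : ∀ {z} → z ∈ Y → Trapped (M .to) W Y z
    trapped z∈ v∈W z~v = case Y⁻ z∈ of λ { (w , z∈Yw) →
      case proj₁ (proj₂ (proj₂ (blocked w))) z∈Yw v∈W z~v of λ { (y , y∈Yw , e) → y , Y⁺ w y∈Yw , e } }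

  record MaximumIndependent (U W : Sub n) : Set where
    field
      within      : W ⊆ U
      independent : Independent W
      maximum     : ∀ {W′} → W′ ⊆ U → Independent W′ → # W′ ≤ # W

  open MaximumIndependent

  maximumIndependent : ∀ U → ∃ (MaximumIndependent U)
  maximumIndependent U = lookup s , record
    { within = λ {u} → proj₁ s-ok u ; independent = λ {u} {v} → proj₂ s-ok u v ; maximum = s-maximum }
    where
    Ok : Sub n → Set
    Ok P = (∀ u → u ∈ P → u ∈ U) × (∀ u v → u ∈ P → v ∈ P → ¬ (u ~ v))
    ok? : ∀ P → Dec (Ok P)
    ok? P = all? (λ u → (u ∈? P) →-dec (u ∈? U)) ×-dec
            all? (λ u → all? λ v → (u ∈? P) →-dec ((v ∈? P) →-dec ¬? (u ~? v)))
    -- The `suc` makes even the empty set, which is independent, beat every set that is not `Ok`;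
    -- hence the maximiser is `Ok`.
    size : Sub n → ℕ
    size P = if does (ok? P) then suc (# P) else 0
    size-ok : ∀ {P} → Ok P → size P ≡ suc (# P)
    size-ok {P} ok rewrite dec-true (ok? P) ok = refl
    size-ko : ∀ {P} → ¬ Ok P → size P ≡ 0
    size-ko {P} ko rewrite dec-false (ok? P) ko = refl
    s : Vec Bool n
    s = proj₁ (argmax (size ∘ lookup))
    s-max : ∀ {P} → Ok P → suc (# P) ≤ size (lookup s)
    s-max {P} (sub , ind) = begin
      suc (# P)                 ≡⟨ cong suc (#-cong (λ x → sym (back x))) ⟩
      suc (# P′)                ≡⟨ sym (size-ok ok′) ⟩
      size P′                   ≤⟨ proj₂ (argmax (size ∘ lookup)) (tabulate P) ⟩
      size (lookup s)           ∎
      where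
      open ≤-Reasoning
      P′ : Sub n
      P′ = lookup (tabulate P)
      back : ∀ x → P′ x ≡ P x
      back = lookup∘tabulate P
      ok′ : Ok P′
      ok′ = (λ u u∈ → sub u (trans (sym (back u)) u∈)) ,
            λ u v u∈ v∈ → ind u v (trans (sym (back u)) u∈) (trans (sym (back v)) v∈)
    s-ok : Ok (lookup s)
    s-ok with ok? (lookup s)
    ... | yes ok = ok
    ... | no ko with () ← subst (_ ≤_) (size-ko ko) (s-max {λ _ → false} ((λ _ ()) , λ _ _ ()))
    s-maximum : ∀ {W′} → W′ ⊆ U → Independent W′ → # W′ ≤ # (lookup s)
    s-maximum sub ind = ≤-pred (subst (_ ≤_) (size-ok s-ok) (s-max ((λ _ → sub) , λ _ _ → ind)))

  -- A set Y ∪ {x} whose neighbours in W are all matched to Y could replace them in W.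
  not-trapped : ∀ {U W I Y x} → MaximumIndependent U W → I ⊆ U ∖ W → Independent I →
                (f : Fin n → Fin n) → Y ⊆ I → (∀ {z} → z ∈ Y → Trapped f W Y z) → x ∈ I → x ∉ Y →
                ¬ Trapped f W Y x
  not-trapped {U} {W} {I} {Y} {x} W-max I⊆ I-ind f Y⊆I Y-trapped x∈I x∉Y x-trapped =
    <⇒≱ larger (W-max .maximum W′⊆U W′-ind)
    where
    image : Sub n
    image w = does (any? λ y → (y ∈? Y) ×-dec (f y ≟ w))
    Yx : Sub n
    Yx = Y ∪ ⁅ x ⁆
    Yx⁻ : ∀ {z} → z ∈ Yx → z ∈ I × Trapped f W Y z
    Yx⁻ {z} z∈ with ∨⁻ {Y z} z∈
    ... | inj₁ z∈Y = Y⊆I z∈Y , Y-trapped z∈Y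
    ... | inj₂ z∈x = subst (λ z → z ∈ I × Trapped f W Y z) (sym (∈⁅⁆⁻ z∈x)) (x∈I , λ {_} → x-trapped)
    W′ : Sub n
    W′ = (W ∖ image) ∪ Yx
    I∌W : ∀ {z} → z ∈ I → z ∉ W
    I∌W {z} z∈I = not⁻ (proj₂ (∧⁻ {U z} (I⊆ z∈I)))
    W∖ : ∀ {z} → z ∈ W ∖ image → z ∈ W × ¬ (∃ λ y → y ∈ Y × f y ≡ z)
    W∖ {z} z∈ with ∧⁻ {W z} z∈
    ... | z∈W , z∉ = z∈W , not⁻ z∉ ∘ dec-true (any? _)
    W′⊆U : W′ ⊆ U
    W′⊆U {z} z∈ with ∨⁻ {(W ∖ image) z} z∈
    ... | inj₁ z∈W = W-max .within (proj₁ (W∖ z∈W))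
    ... | inj₂ z∈Yx = proj₁ (∧⁻ {U z} (I⊆ (proj₁ (Yx⁻ z∈Yx))))
    -- Any neighbour in `W` of a trapped vertex lies in `image`, which has been removed.
    cross : ∀ {y w} → y ∈ Yx → w ∈ W ∖ image → ¬ (y ~ w)
    cross y∈ w∈ y~w = proj₂ (W∖ w∈) (proj₂ (Yx⁻ y∈) (proj₁ (W∖ w∈)) y~w)
    W′-ind : Independent W′
    W′-ind {u} {v} u∈ v∈ u~v with ∨⁻ {(W ∖ image) u} u∈ | ∨⁻ {(W ∖ image) v} v∈
    ... | inj₁ u∈W | inj₁ v∈W = W-max .independent (proj₁ (W∖ u∈W)) (proj₁ (W∖ v∈W)) u~v
    ... | inj₁ u∈W | inj₂ v∈Y = cross v∈Y u∈W (~-sym u~v)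
    ... | inj₂ u∈Y | inj₁ v∈W = cross u∈Y v∈W u~v
    ... | inj₂ u∈Y | inj₂ v∈Y = I-ind (proj₁ (Yx⁻ u∈Y)) (proj₁ (Yx⁻ v∈Y)) u~v
    image⁻ : ∀ {w} → w ∈ image → ∃ λ y → y ∈ Y × f y ≡ w
    image⁻ = does⁻ (any? _)
    -- Choosing preimages bounds `# image` by `# Y`; the value outside `image` is a filler.
    back : Fin n → Fin n
    back w with w ∈? image
    ... | yes w∈ = proj₁ (image⁻ w∈)
    ... | no _   = w
    back-spec : ∀ {w} → w ∈ image → back w ∈ Y × f (back w) ≡ w
    back-spec {w} w∈ with w ∈? image
    ... | yes w∈′ = proj₂ (image⁻ w∈′)
    ... | no w∉   = ⊥-elim (w∉ w∈)
    #image≤ : # image ≤ # Y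
    #image≤ = #-inj back (proj₁ ∘ back-spec) λ u∈ v∈ e →
      trans (sym (proj₂ (back-spec u∈))) (trans (cong f e) (proj₂ (back-spec v∈)))
    -- At most `# Y` vertices leave `W`, and `# Y + 1` enter.
    larger : # W < # W′
    larger = begin-strict
      # W                            ≡⟨ trans (#-split W image) (+-comm (# (W ∩ image)) _) ⟩
      # (W ∖ image) + # (W ∩ image)   ≤⟨ +-monoʳ-≤ (# (W ∖ image))
                                        (≤-trans (#-mono {P = W ∩ image} (λ {w} → proj₂ ∘ ∧⁻ {W w})) #image≤) ⟩
      # (W ∖ image) + # Y            <⟨ +-monoʳ-< (# (W ∖ image)) (#-strict {P = Y} {Yx} ∨⁺ˡ (∨⁺ʳ (∈⁅⁆ x)) x∉Y) ⟩
      # (W ∖ image) + # Yx           ≡⟨ sym (#-∪ (W ∖ image) Yx (λ w∈ w∈′ → I∌W (proj₁ (Yx⁻ w∈′)) (proj₁ (W∖ w∈)))) ⟩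
      # W′                           ∎
      where
      open ≤-Reasoning

  abstract
    -- The vertices of `I` are matched one at a time by `augment`; its other outcome would
    -- contradict the maximality of `W` by `not-trapped`.
    matching : ∀ {U W I} → MaximumIndependent U W → I ⊆ U ∖ W → Independent I → Matching I W
    matching {U} {W} W-max = go _ ≤-refl
      where
      go : ∀ k {I} → # I ≤ k → I ⊆ U ∖ W → Independent I → Matching I W
      go k {I} #I≤k I⊆ I-ind with any? (_∈? I)
      ... | no empty = record { to = id ; edge = λ z∈ → ⊥-elim (empty (_ , z∈))
                              ; into = λ z∈ → ⊥-elim (empty (_ , z∈)) ; inj = λ z∈ → ⊥-elim (empty (_ , z∈)) }
      go zero    {I} #I≤k I⊆ I-ind | yes (x , x∈I) with () ← ≤-trans (#-pos {P = I} x∈I) #I≤k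
      go (suc k) {I} #I≤k I⊆ I-ind | yes (x , x∈I) = case augment _ M x ≤-refl of λ
        { (inj₁ M′) → restrict whole id M′
        ; (inj₂ (Y , Y⊆ , trap , trap′)) → ⊥-elim (not-trapped W-max I⊆ I-ind (M .to) (I∖⊆ ∘ Y⊆) trap x∈I
            (λ x∈Y → proj₂ (∖⁅⁆⁻ {P = I} (Y⊆ x∈Y)) refl) trap′) }
        where
        I∖⊆ : I ∖ ⁅ x ⁆ ⊆ I
        I∖⊆ z∈ = proj₁ (∖⁅⁆⁻ {P = I} z∈)
        M : Matching (I ∖ ⁅ x ⁆) W
        M = go k (≤-pred (subst (_≤ suc k) (#-remove {P = I} x∈I) #I≤k)) (I⊆ ∘ I∖⊆)
                 (λ u∈ v∈ → I-ind (I∖⊆ u∈) (I∖⊆ v∈))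
        whole : I ⊆ (I ∖ ⁅ x ⁆) ∪ ⁅ x ⁆
        whole {z} z∈I with z ≟ x
        ... | yes _ = ∨⁺ʳ {I z ∧ false} refl
        ... | no _  = ∨⁺ˡ (∧⁺ z∈I refl)

  -- Layers of successively maximum independent sets

  abstract
    Up Layer : (Fin n → ℕ) → ℕ → Sub n
    Up    r i v = does (i ≤? r v)
    Layer r i v = does (r v ℕ.≟ i)

    Up⁻ : ∀ r i {v} → v ∈ Up r i → i ≤ r v
    Up⁻ r i {v} = does⁻ (i ≤? r v)

    Up⁺ : ∀ r i {v} → i ≤ r v → v ∈ Up r i
    Up⁺ r i {v} = dec-true (i ≤? r v)

    Layer⁻ : ∀ r i {v} → v ∈ Layer r i → r v ≡ i
    Layer⁻ r i {v} = does⁻ (r v ℕ.≟ i)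

    Layer⁺ : ∀ r i {v} → r v ≡ i → v ∈ Layer r i
    Layer⁺ r i {v} = dec-true (r v ℕ.≟ i)

  -- The layers below `k` are final, and the value `k` marks everything not yet peeled off.
  Layered : (Fin n → ℕ) → ℕ → Set
  Layered r k = (∀ v → r v ≤ k) × (∀ {i} → i < k → MaximumIndependent (Up r i) (Layer r i))

  -- Mutual inclusion stands in for equality of sets, which are Boolean functions here.
  MaximumIndependent-resp : ∀ {U U′ W W′} → U ⊆ U′ → U′ ⊆ U → W ⊆ W′ → W′ ⊆ W →
                            MaximumIndependent U W → MaximumIndependent U′ W′
  MaximumIndependent-resp {W = W} {W′} U⊆ U⊇ W⊆ W⊇ max = record
    { within      = λ v∈ → U⊆ (max .within (W⊇ v∈))
    ; independent = λ u∈ v∈ → max .independent (W⊇ u∈) (W⊇ v∈)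
    ; maximum     = λ sub ind → ≤-trans (max .maximum (λ v∈ → U⊇ (sub v∈)) ind) (#-mono {P = W} {W′} W⊆)
    }

  addLayer : ∀ {r k} → Layered r k → ∃ λ r′ → Layered r′ (suc k)
  addLayer {r} {k} (r≤k , r-max) = r′ , r′≤ , r′-max
    where
    W : Sub n
    W = proj₁ (maximumIndependent (Up r k))
    W-max : MaximumIndependent (Up r k) W
    W-max = proj₂ (maximumIndependent (Up r k))
    -- The chosen set `W` keeps the value `k`; the rest of the remainder moves up to `k + 1`.
    r′ : Fin n → ℕ
    r′ v = r v + 𝟙 ((Up r k ∖ W) v)
    data Moved (v : Fin n) : Set where
      stays : r v < k ⊎ v ∈ W → r′ v ≡ r v → Moved v
      moves : k ≤ r v → v ∉ W → r′ v ≡ suc (r v) → Moved v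
    moved : ∀ v → Moved v
    moved v with k ≤? r v | v ∈? W
    ... | no k≰r | _ = stays (inj₁ (≰⇒> k≰r))
      (trans (cong (λ b → r v + 𝟙 (b ∧ not (W v))) (¬-not (k≰r ∘ Up⁻ r k))) (+-identityʳ _))
    ... | yes k≤r | yes v∈W = stays (inj₂ v∈W)
      (trans (cong₂ (λ b c → r v + 𝟙 (b ∧ not c)) (Up⁺ r k k≤r) v∈W) (+-identityʳ _))
    ... | yes k≤r | no v∉W = moves k≤r v∉W
      (trans (cong₂ (λ b c → r v + 𝟙 (b ∧ c)) (Up⁺ r k k≤r) (not⁺ v∉W)) (+-comm (r v) 1))
    r′≤ : ∀ v → r′ v ≤ suc k
    r′≤ v = ≤-trans (+-mono-≤ (r≤k v) (𝟙≤1 _)) (≤-reflexive (+-comm k 1))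
    Up⊆ : ∀ i → Up r i ⊆ Up r′ i
    Up⊆ i v∈ = Up⁺ r′ i (≤-trans (Up⁻ r i v∈) (m≤m+n _ _))
    Up⊇ : ∀ i → i ≤ k → Up r′ i ⊆ Up r i
    Up⊇ i i≤k {v} v∈ with moved v
    ... | stays _ same  = Up⁺ r i (subst (i ≤_) same (Up⁻ r′ i v∈))
    ... | moves k≤r _ _ = Up⁺ r i (≤-trans i≤k k≤r)
    Layer⊆ : ∀ i → i < k → Layer r i ⊆ Layer r′ i
    Layer⊆ i i<k {v} v∈ with moved v
    ... | stays _ same  = Layer⁺ r′ i (trans same (Layer⁻ r i v∈))
    ... | moves k≤r _ _ = ⊥-elim (<⇒≱ i<k (subst (k ≤_) (Layer⁻ r i v∈) k≤r))
    Layer⊇ : ∀ i → i ≤ k → Layer r′ i ⊆ Layer r i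
    Layer⊇ i i≤k {v} v∈ with moved v
    ... | stays _ same = Layer⁺ r i (trans (sym same) (Layer⁻ r′ i v∈))
    ... | moves k≤r _ up = ⊥-elim (<⇒≱ (s≤s k≤r) (subst (_≤ k) (trans (sym (Layer⁻ r′ i v∈)) up) i≤k))
    W⊆ : W ⊆ Layer r′ k
    W⊆ {v} v∈W with moved v
    ... | stays _ same  = Layer⁺ r′ k (trans same (≤-antisym (r≤k v) (Up⁻ r k (W-max .within v∈W))))
    ... | moves _ v∉W _ = ⊥-elim (v∉W v∈W)
    W⊇ : Layer r′ k ⊆ W
    W⊇ {v} v∈ with moved v
    ... | stays (inj₂ v∈W) _ = v∈W
    ... | stays (inj₁ r<k) same = ⊥-elim (<⇒≢ r<k (trans (sym same) (Layer⁻ r′ k v∈)))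
    ... | moves k≤r _ up = ⊥-elim (<⇒≢ (s≤s k≤r) (sym (trans (sym up) (Layer⁻ r′ k v∈))))
    r′-max : ∀ {i} → i < suc k → MaximumIndependent (Up r′ i) (Layer r′ i)
    r′-max {i} (s≤s i≤k) with m≤n⇒m<n∨m≡n i≤k
    ... | inj₁ i<k  = MaximumIndependent-resp (Up⊆ i) (Up⊇ i i≤k) (Layer⊆ i i<k) (Layer⊇ i i≤k) (r-max i<k)
    ... | inj₂ refl = MaximumIndependent-resp (Up⊆ k) (Up⊇ k ≤-refl) W⊆ W⊇ W-max

  abstract
    layering : ∀ k → ∃ λ r → Layered r k
    layering zero    = (λ _ → 0) , (λ _ → z≤n) , λ ()
    layering (suc k) = addLayer (proj₂ (layering k))

  -- Layers and degree counts for maximum degree at most six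

  module Construction (r : Fin n → ℕ) (layered : Layered r 7) (Δ≤6 : ∀ v → # (adj G v) ≤ 6) where

    r-max : ∀ {i} → i < 7 → MaximumIndependent (Up r i) (Layer r i)
    r-max = proj₂ layered

    -- This is `matching` applied to the singleton of `v`.
    below : ∀ {v i} → i < r v → ∃ λ w → v ~ w × r w ≡ i
    below {v} {i} i<r = M .to v , M .edge (∈⁅⁆ v) , Layer⁻ r i (M .into (∈⁅⁆ v))
      where
      single : ∀ {u} → u ∈ ⁅ v ⁆ → u ≡ v
      single = ∈⁅⁆⁻
      M : Matching ⁅ v ⁆ (Layer r i)
      M = matching (r-max (≤-trans i<r (proj₁ layered v)))
        (λ u∈ → subst (_∈ Up r i ∖ Layer r i) (sym (single u∈))
          (∧⁺ (Up⁺ r i (<⇒≤ i<r)) (not⁺ λ v∈ → <⇒≢ i<r (sym (Layer⁻ r i v∈)))))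
        (λ u∈ w∈ u~w → ~-irrefl (subst (_~ v) (single u∈) (subst (_ ~_) (single w∈) u~w)))

    -- Take one neighbour from each of the layers `a`, ..., `a + m - 1`; they are distinct because
    -- `r` separates them.
    #-below : ∀ {v} a m {Q} → a + m ≤ r v → (∀ {w} → v ~ w → a ≤ r w → r w < a + m → w ∈ Q) → m ≤ # Q
    #-below {v} a m {Q} a+m≤r into = subst (_≤ # Q) (#-full m) (#-inj f {λ _ → true} {Q}
        (λ {i} _ → into (proj₁ (f-spec i)) (subst (a ≤_) (sym (proj₂ (f-spec i))) (m≤m+n a _))
                        (subst (_< a + m) (sym (proj₂ (f-spec i))) (+-monoʳ-< a (toℕ<n i))))
        (λ {i} {j} _ _ e → toℕ-injective (+-cancelˡ-≡ a _ _
          (trans (sym (proj₂ (f-spec i))) (trans (cong r e) (proj₂ (f-spec j)))))))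
      where
      nbr : (i : Fin m) → ∃ λ w → v ~ w × r w ≡ a + toℕ i
      nbr i = below (≤-trans (+-monoʳ-< a (toℕ<n i)) a+m≤r)
      f : Fin m → Fin n
      f i = proj₁ (nbr i)
      f-spec : ∀ i → v ~ f i × r (f i) ≡ a + toℕ i
      f-spec i = proj₂ (nbr i)

    -- A vertex left over after seven layers would have a neighbour in each of them, but there are
    -- at most six neighbours. So every vertex lies in one of the independent layers.
    r≤6 : ∀ v → r v ≤ 6
    r≤6 v with m≤n⇒m<n∨m≡n (proj₁ layered v)
    ... | inj₁ r<7 = ≤-pred r<7
    ... | inj₂ r≡7 = ⊥-elim (<⇒≱ (#-below 0 7 {adj G v} (≤-reflexive (sym r≡7)) (λ v~w _ _ → v~w)) (Δ≤6 v))

    r-proper : ∀ {u v} → u ~ v → r u ≢ r v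
    r-proper {u} {v} u~v e = r-max (s≤s (r≤6 u)) .independent {u} {v} (Layer⁺ r (r u) refl) (Layer⁺ r (r u) (sym e)) u~v

    D higher : Fin n → ℕ
    D v      = # (adj G v ∩ Up r 3)
    higher v = # ((adj G v ∩ Up r 3) ∩ Up r (suc (r v)))

    D≤3 : ∀ {v} → 3 ≤ r v → D v ≤ 3
    D≤3 {v} 3≤r = +-cancelʳ-≤ 3 (D v) 3 (begin
      D v + 3                        ≤⟨ +-monoʳ-≤ (D v) (#-below 0 3 {adj G v ∖ Up r 3} 3≤r
                                          (λ v~w _ r<3 → ∧⁺ v~w (not⁺ λ w∈ → <⇒≱ r<3 (Up⁻ r 3 w∈)))) ⟩
      D v + # (adj G v ∖ Up r 3)      ≡⟨ sym (#-split (adj G v) (Up r 3)) ⟩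
      # (adj G v)                    ≤⟨ Δ≤6 v ⟩
      6                              ∎)
      where open ≤-Reasoning

    -- Among the `D v` neighbours in layers from 3 upwards, at least `r v - 3` lie below `v`, one in
    -- each of the layers 3, ..., `r v - 1`.
    higher+r≤D+3 : ∀ {v} → 3 ≤ r v → higher v + r v ≤ D v + 3
    higher+r≤D+3 {v} 3≤r = begin
      higher v + r v                 ≡⟨ cong (higher v +_) (sym (m∸n+n≡m 3≤r)) ⟩
      higher v + (r v ∸ 3 + 3)       ≡⟨ sym (+-assoc (higher v) _ 3) ⟩
      higher v + (r v ∸ 3) + 3       ≤⟨ +-monoˡ-≤ 3 (+-monoʳ-≤ (higher v) lower) ⟩
      higher v + # (N ∖ Up r (suc (r v))) + 3 ≡⟨ cong (_+ 3) (sym (#-split N (Up r (suc (r v))))) ⟩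
      D v + 3                        ∎
      where
      open ≤-Reasoning
      N : Sub n
      N = adj G v ∩ Up r 3
      lower : r v ∸ 3 ≤ # (N ∖ Up r (suc (r v)))
      lower = #-below 3 (r v ∸ 3) {N ∖ Up r (suc (r v))} (≤-reflexive (m+[n∸m]≡n 3≤r)) λ {w} v~w 3≤w w< →
        ∧⁺ (∧⁺ v~w (Up⁺ r 3 3≤w)) (not⁺ λ w∈ → <-asym (Up⁻ r (suc (r v)) w∈) (subst (r w <_) (m+[n∸m]≡n 3≤r) w<))

    abstract
      E : Fin n → ℕ
      E v = D v + 3 ∸ r v

      -- The truncated subtraction in `E` is exact here, as `higher+r≤D+3` gives `r v ≤ D v + 3`.
      E+r≡D+3 : ∀ {v} → 3 ≤ r v → E v + r v ≡ D v + 3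
      E+r≡D+3 {v} 3≤r = m∸n+n≡m (≤-trans (m≤n+m (r v) (higher v)) (higher+r≤D+3 3≤r))

    higher≤E : ∀ {v} → 3 ≤ r v → higher v ≤ E v
    higher≤E {v} 3≤r = +-cancelʳ-≤ (r v) _ _ (≤-trans (higher+r≤D+3 3≤r) (≤-reflexive (sym (E+r≡D+3 3≤r))))

    E≤3 : ∀ {v} → 3 ≤ r v → E v ≤ 3
    E≤3 {v} 3≤r = +-cancelʳ-≤ 3 _ _ (begin
      E v + 3    ≤⟨ +-monoʳ-≤ (E v) 3≤r ⟩
      E v + r v  ≡⟨ E+r≡D+3 3≤r ⟩
      D v + 3    ≤⟨ +-monoˡ-≤ 3 (D≤3 3≤r) ⟩
      6          ∎)
      where open ≤-Reasoning

    higher∋ : ∀ {v w} → 3 ≤ r v → v ~ w → r v < r w → w ∈ (adj G v ∩ Up r 3) ∩ Up r (suc (r v))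
    higher∋ {v} {w} 3≤r v~w v<w = ∧⁺ (∧⁺ v~w (Up⁺ r 3 (≤-trans 3≤r (<⇒≤ v<w)))) (Up⁺ r (suc (r v)) v<w)

    -- The forest of tight vertices

    Tight : Fin n → Set
    Tight v = 3 ≤ r v × E v ≤ 1

    tight? : ∀ v → Dec (Tight v)
    tight? v = (3 ≤? r v) ×-dec (E v ≤? 1)

    -- `E v` bounds the number of higher neighbours, and it is at most 1 for tight `v`.
    unique-higher : ∀ {v w w′} → Tight v → v ~ w → r v < r w → v ~ w′ → r v < r w′ → w ≡ w′
    unique-higher {v} {w} {w′} (3≤r , E≤1) v~w v<w v~w′ v<w′ with w ≟ w′
    ... | yes w≡w′ = w≡w′
    ... | no w≢w′ = ⊥-elim (<⇒≱ (≤-trans (s≤s (#-pos {P = S ∖ ⁅ w ⁆}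
                               (∈∖⁅⁆ {P = S} (higher∋ 3≤r v~w′ v<w′) (w≢w′ ∘ sym))))
                             (≤-reflexive (sym (#-remove {P = S} (higher∋ 3≤r v~w v<w)))))
                     (≤-trans (higher≤E 3≤r) E≤1))
      where
      S : Sub n
      S = (adj G v ∩ Up r 3) ∩ Up r (suc (r v))

    -- Each tight vertex has at most one tight neighbour above it, so the tight vertices induce
    -- a forest; it is 2-coloured from the top layer downwards.
    TwoColoured : ℕ → Sub n → Set
    TwoColoured j σ = ∀ {u v} → Tight u → Tight v → u ~ v → 7 ≤ r u + j → 7 ≤ r v + j → σ u ≢ σ v

    twoColour : ∀ j → ∃ (TwoColoured j)
    -- No vertex has value 7 or more, so any colouring will do.
    twoColour zero = (λ _ → true) , λ {u} _ _ _ 7≤ _ → ⊥-elim (<⇒≱ 7≤ (subst (_≤ 6) (sym (+-identityʳ (r u))) (r≤6 u)))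
    twoColour (suc j) with twoColour j
    ... | σ , σ-proper = σ′ , σ′-proper
      where
      parent? : ∀ u → Dec (∃ λ w → u ~ w × r u < r w)
      parent? u = any? λ w → (u ~? w) ×-dec (suc (r u) ≤? r w)
      -- The opposite of the colour of a higher neighbour; without one the colour is free and `true`
      -- is chosen.
      colour : ∀ {u} → Dec (∃ λ w → u ~ w × r u < r w) → Bool
      colour (yes (w , _)) = not (σ w)
      colour (no _)        = true
      -- Stage `suc j` colours the layer `6 - j`.
      new : Fin n → Bool
      new u = does (r u + suc j ℕ.≟ 7)
      σ′ : Sub n
      σ′ u = if new u then colour (parent? u) else σ u
      data Age (u : Fin n) : Set where
        is-new : r u + suc j ≡ 7 → σ′ u ≡ colour (parent? u) → Age u
        is-old : 7 ≤ r u + j → σ′ u ≡ σ u → Age u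
      age : ∀ {u} → 7 ≤ r u + suc j → Age u
      age {u} 7≤ with r u + suc j ℕ.≟ 7
      ... | yes e = is-new e (cong (if_then colour (parent? u) else σ u) (dec-true (r u + suc j ℕ.≟ 7) e))
      ... | no ne = is-old (≤-pred (subst (7 <_) (+-suc (r u) j) (≤∧≢⇒< 7≤ (λ e → ne (sym e)))))
                           (cong (if_then colour (parent? u) else σ u) (dec-false (r u + suc j ℕ.≟ 7) ne))
      above : ∀ {u v} → r u + suc j ≡ 7 → 7 ≤ r v + j → r u < r v
      above {u} {v} e 7≤ = +-cancelʳ-< j _ _ (subst (_≤ r v + j) (trans (sym e) (+-suc (r u) j)) 7≤)
      -- The search in `parent?` may return any higher neighbour, but for tight `u` it can only be
      -- `v`.
      flip : ∀ {u v} → Tight u → u ~ v → r u < r v → colour (parent? u) ≢ σ v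
      flip {u} {v} tu u~v u<v with parent? u
      ... | no none = λ _ → none (v , u~v , u<v)
      ... | yes (w , u~w , u<w) rewrite unique-higher tu u~w u<w u~v u<v = not-¬ refl ∘ sym
      σ′-proper : TwoColoured (suc j) σ′
      σ′-proper {u} {v} tu tv u~v 7≤u 7≤v e with age 7≤u | age 7≤v
      ... | is-old ou eu | is-old ov ev = σ-proper tu tv u~v ou ov (trans (sym eu) (trans e ev))
      ... | is-new nu eu | is-old ov ev = flip tu u~v (above nu ov) (trans (sym eu) (trans e ev))
      ... | is-old ou eu | is-new nv ev = flip tv (~-sym u~v) (above nv ou) (trans (sym ev) (trans (sym e) eu))
      ... | is-new nu _  | is-new nv _  = r-proper u~v (+-cancelʳ-≡ (suc j) _ _ (trans nu (sym nv)))

    abstract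
      σ : Sub n
      -- For `j = 7` the condition `7 ≤ r u + j` holds for every vertex.
      σ = proj₁ (twoColour 7)

      σ-twoColours : TwoColoured 7 σ
      σ-twoColours = proj₂ (twoColour 7)

    abstract
      Tights : Sub n
      Tights v = does (tight? v)

      Tights⁻ : ∀ {v} → v ∈ Tights → Tight v
      Tights⁻ {v} = does⁻ (tight? v)

      Tights⁺ : ∀ {v} → Tight v → v ∈ Tights
      Tights⁺ {v} = dec-true (tight? v)

    -- Edges of H between the upper layers and V₂

    Tights₁ Tights₂ : Sub n
    Tights₁ = Tights ∩ σ
    Tights₂ = Tights ∖ σ

    σ-proper : ∀ {u v} → u ∈ Tights → v ∈ Tights → u ~ v → σ u ≢ σ v
    σ-proper u∈ v∈ u~v = σ-twoColours (Tights⁻ u∈) (Tights⁻ v∈) u~v (m≤n+m 7 _) (m≤n+m 7 _)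

    Tights⊆ : Tights ⊆ Up r 2 ∖ Layer r 2
    Tights⊆ v∈ = case Tights⁻ v∈ of λ { (3≤r , _) →
      ∧⁺ (Up⁺ r 2 (<⇒≤ 3≤r)) (not⁺ λ v∈₂ → <⇒≢ 3≤r (sym (Layer⁻ r 2 v∈₂))) }

    abstract
      matching₁ : Matching Tights₁ (Layer r 2)
      matching₁ = matching (r-max (s≤s (s≤s (s≤s z≤n)))) (λ {v} v∈ → Tights⊆ (proj₁ (∧⁻ {Tights v} v∈)))
        λ {u} {v} u∈ v∈ u~v → case ∧⁻ {Tights u} u∈ , ∧⁻ {Tights v} v∈ of λ { ((tu , σu) , tv , σv) →
          σ-proper tu tv u~v (trans σu (sym σv)) }

      matching₂ : Matching Tights₂ (Layer r 2)
      matching₂ = matching (r-max (s≤s (s≤s (s≤s z≤n)))) (λ {v} v∈ → Tights⊆ (proj₁ (∧⁻ {Tights v} v∈)))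
        λ {u} {v} u∈ v∈ u~v → case ∧⁻ {Tights u} u∈ , ∧⁻ {Tights v} v∈ of λ { ((tu , σu) , tv , σv) →
          σ-proper tu tv u~v (not-injective (trans σu (sym σv))) }

    -- F u is the set of those neighbours of u in V₂ that are joined to u in H.
    column : (Fin n → Sub n) → Fin n → ℕ
    column F p = # (λ u → F u p)

    -- By `E+r≡D+3`, `row≤` says `D u + # (F u) ≤ r u`: the edges chosen so far do not exceed the
    -- target degree of `u`. Likewise `col≤2` respects the target 2 on V₂.
    record Linking (F : Fin n → Sub n) : Set where
      field
        link   : ∀ {u p} → p ∈ F u → u ~ p × 3 ≤ r u × r p ≡ 2
        col≤2  : ∀ p → column F p ≤ 2
        row≤   : ∀ {u} → 3 ≤ r u → # (F u) + E u ≤ 3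
        row-pos : ∀ {u} → Tight u → 1 ≤ # (F u)

    open Linking

    -- In the second case every upper neighbour u of p already has its largest possible degree.
    Served : (Fin n → Sub n) → Fin n → Set
    Served F p = 1 ≤ column F p ⊎ (∀ {u} → u ~ p → 3 ≤ r u → 3 ≤ # (F u) + E u)

    -- Each tight vertex uses the matching of its own colour class. A vertex of V₂ is hit at most
    -- once by each matching, which is why `F-col` splits the column by `σ`.
    twoMatchings : ∃ Linking
    twoMatchings = F , record { link = F-link ; col≤2 = F-col ; row≤ = F-row ; row-pos = F-pos }
      where
      f : Fin n → Fin n
      f u = if σ u then matching₁ .to u else matching₂ .to u
      F : Fin n → Sub n
      F u p = Tights u ∧ ⁅ f u ⁆ p
      f-spec : ∀ {u} → u ∈ Tights → u ~ f u × r (f u) ≡ 2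
      f-spec {u} u∈ with σ u in σu
      ... | true  = matching₁ .edge (∧⁺ u∈ σu) , Layer⁻ r 2 (matching₁ .into (∧⁺ u∈ σu))
      ... | false = matching₂ .edge u∈₂ , Layer⁻ r 2 (matching₂ .into u∈₂)
        where
        u∈₂ : u ∈ Tights₂
        u∈₂ = ∧⁺ u∈ (cong not σu)
      F⁻ : ∀ u p → p ∈ F u → u ∈ Tights × p ≡ f u
      F⁻ u p p∈ = case ∧⁻ {Tights u} p∈ of λ { (u∈ , p∈f) → u∈ , ∈⁅⁆⁻ p∈f }
      F-link : ∀ {u p} → p ∈ F u → u ~ p × 3 ≤ r u × r p ≡ 2
      F-link {u} {p} p∈ = case F⁻ u p p∈ of λ { (u∈ , e) → subst (u ~_) (sym e) (proj₁ (f-spec u∈)) ,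
        proj₁ (Tights⁻ u∈) , trans (cong r e) (proj₂ (f-spec u∈)) }
      F-col : ∀ p → column F p ≤ 2
      F-col p = ≤-trans (≤-reflexive (#-split (λ u → F u p) σ)) (+-mono-≤
        (#-≤1 {P = (λ u → F u p) ∩ σ} (λ {u} {v} u∈ v∈ → one (∧⁻ {F u p} u∈) (∧⁻ {F v p} v∈)))
        (#-≤1 {P = (λ u → F u p) ∖ σ} (λ {u} {v} u∈ v∈ → two (∧⁻ {F u p} u∈) (∧⁻ {F v p} v∈))))
        where
        one : ∀ {u v} → F u p ≡ true × σ u ≡ true → F v p ≡ true × σ v ≡ true → u ≡ v
        one {u} {v} (u∈ , σu) (v∈ , σv) = matching₁ .inj (∧⁺ (proj₁ (F⁻ u p u∈)) σu) (∧⁺ (proj₁ (F⁻ v p v∈)) σv)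
          (trans (sym (f≡ σu)) (trans (sym (proj₂ (F⁻ u p u∈))) (trans (proj₂ (F⁻ v p v∈)) (f≡ σv))))
          where
          f≡ : ∀ {w} → σ w ≡ true → f w ≡ matching₁ .to w
          f≡ {w} = cong (if_then matching₁ .to w else matching₂ .to w)
        two : ∀ {u v} → F u p ≡ true × not (σ u) ≡ true → F v p ≡ true × not (σ v) ≡ true → u ≡ v
        two {u} {v} (u∈ , σu) (v∈ , σv) = matching₂ .inj (∧⁺ (proj₁ (F⁻ u p u∈)) σu) (∧⁺ (proj₁ (F⁻ v p v∈)) σv)
          (trans (sym (f≡ σu)) (trans (sym (proj₂ (F⁻ u p u∈))) (trans (proj₂ (F⁻ v p v∈)) (f≡ σv))))
          where
          f≡ : ∀ {w} → not (σ w) ≡ true → f w ≡ matching₂ .to w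
          f≡ {w} e = cong (if_then matching₁ .to w else matching₂ .to w) (not-injective e)
      F-row : ∀ {u} → 3 ≤ r u → # (F u) + E u ≤ 3
      F-row {u} 3≤r with u ∈? Tights
      ... | yes u∈ = +-mono-≤ {_} {2} (≤-trans one (s≤s z≤n)) (proj₂ (Tights⁻ u∈))
        where
        one : # (F u) ≤ 1
        one = #-≤1 {P = F u} λ {p} {q} p∈ q∈ → trans (proj₂ (F⁻ u p p∈)) (sym (proj₂ (F⁻ u q q∈)))
      ... | no u∉ = +-mono-≤ (≤-reflexive (#-∅ {P = F u} λ p p∈ → u∉ (proj₁ (F⁻ u p p∈)))) (E≤3 3≤r)
      F-pos : ∀ {u} → Tight u → 1 ≤ # (F u)
      F-pos {u} tu = #-pos {x = f u} {F u} (∧⁺ (Tights⁺ tu) (∈⁅⁆ (f u)))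

    -- Both alternatives are lower bounds on sizes, so adding edges for later vertices cannot undo
    -- earlier service.
    Served-mono : ∀ {F F′ p} → (∀ u → F u ⊆ F′ u) → Served F p → Served F′ p
    Served-mono {F} {F′} {p} F⊆ (inj₁ pos)  = inj₁ (≤-trans pos (#-mono {P = λ u → F u p} {λ u → F′ u p} (λ {u} → F⊆ u)))
    Served-mono {F} {F′} F⊆ (inj₂ full) = inj₂ λ {u} u~p 3≤r →
      ≤-trans (full u~p 3≤r) (+-monoˡ-≤ (E u) (#-mono {P = F u} (F⊆ u)))

    -- An edge is added only when the column of `p` is empty and some upper neighbour `u` has room.
    -- The column then has size 1, and the row of `u` grows by one within its bound.
    serve : ∀ {F} p → r p ≡ 2 → Linking F → ∃ λ F′ → Linking F′ × (∀ u → F u ⊆ F′ u) × Served F′ p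
    serve {F} p rp≡2 L with 1 ≤? column F p | any? (λ u → (u ~? p) ×-dec ((3 ≤? r u) ×-dec (suc (# (F u) + E u) ≤? 3)))
    ... | yes pos | _ = F , L , (λ _ → id) , inj₁ pos
    ... | no _ | no full = F , L , (λ _ → id) , inj₂ λ {u} u~p 3≤r → ≮⇒≥ λ room → full (u , u~p , 3≤r , room)
    ... | no p-free | yes (u , u~p , 3≤r , room) = F′ , L′ , (λ _ → ∨⁺ˡ) ,
          inj₁ (#-pos {x = u} {λ v → F′ v p} (∨⁺ʳ {F u p} (∧⁺ (∈⁅⁆ u) (∈⁅⁆ p))))
      where
      F′ : Fin n → Sub n
      F′ v q = F v q ∨ (⁅ u ⁆ v ∧ ⁅ p ⁆ q)
      F′⁻ : ∀ {v q} → q ∈ F′ v → q ∈ F v ⊎ (v ≡ u × q ≡ p)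
      F′⁻ {v} {q} q∈ with ∨⁻ {F v q} q∈
      ... | inj₁ old = inj₁ old
      ... | inj₂ new = case ∧⁻ {⁅ u ⁆ v} new of λ { (v∈ , q∈p) → inj₂ (∈⁅⁆⁻ v∈ , ∈⁅⁆⁻ q∈p) }
      free : ∀ {v} → p ∉ F v
      free {v} p∈ = p-free (#-pos {x = v} {λ w → F w p} p∈)
      col : ∀ q → Dec (q ≡ p) → column F′ q ≤ 2
      col q (yes q≡p) = ≤-trans (#-≤1 {P = λ v → F′ v q} (λ a b → trans (only a) (sym (only b)))) (s≤s z≤n)
        where
        only : ∀ {v} → q ∈ F′ v → v ≡ u
        only {v} q∈ = case F′⁻ q∈ of λ
          { (inj₁ old) → ⊥-elim (free (subst (_∈ F v) q≡p old)) ; (inj₂ (e , _)) → e }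
      col q (no q≢p) = ≤-trans (#-mono {P = λ v → F′ v q} {λ v → F v q} λ {v} q∈ →
                         case F′⁻ q∈ of λ { (inj₁ old) → old ; (inj₂ (_ , e)) → ⊥-elim (q≢p e) }) (L .col≤2 q)
      row : ∀ {v} → 3 ≤ r v → Dec (v ≡ u) → # (F′ v) + E v ≤ 3
      row {v} _ (yes v≡u) = subst (λ v → # (F′ v) + E v ≤ 3) (sym v≡u) (≤-trans (+-monoˡ-≤ (E u) (begin
          # (F′ u)            ≤⟨ #-mono {P = F′ u} {F u ∪ ⁅ p ⁆} new ⟩
          # (F u ∪ ⁅ p ⁆)      ≡⟨ #-∪ (F u) ⁅ p ⁆ (λ q∈ q∈p → free (subst (_∈ F u) (∈⁅⁆⁻ q∈p) q∈)) ⟩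
          # (F u) + # ⁅ p ⁆    ≡⟨ cong (# (F u) +_) (#-⁅⁆ p) ⟩
          # (F u) + 1         ≡⟨ +-comm (# (F u)) 1 ⟩
          suc (# (F u))       ∎)) room)
        where
        open ≤-Reasoning
        new : F′ u ⊆ F u ∪ ⁅ p ⁆
        new {q} q∈ with F′⁻ {u} {q} q∈
        ... | inj₁ old     = ∨⁺ˡ old
        ... | inj₂ (_ , e) = ∨⁺ʳ {F u q} (subst (_∈ ⁅ p ⁆) (sym e) (∈⁅⁆ p))
      row {v} 3≤r (no v≢u) = ≤-trans (+-monoˡ-≤ (E v) (#-mono {P = F′ v} {F v} λ q∈ →
                               case F′⁻ q∈ of λ { (inj₁ old) → old ; (inj₂ (e , _)) → ⊥-elim (v≢u e) })) (L .row≤ 3≤r)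
      L′ : Linking F′
      L′ .link q∈ with F′⁻ q∈
      ... | inj₁ old           = L .link old
      ... | inj₂ (refl , refl) = u~p , 3≤r , rp≡2
      L′ .col≤2 q = col q (q ≟ p)
      L′ .row≤ {v} 3≤rv = row 3≤rv (v ≟ u)
      L′ .row-pos {v} tv = ≤-trans (L .row-pos tv) (#-mono {P = F v} {F′ v} ∨⁺ˡ)

    serveAll : (ps : List (Fin n)) → ∃ λ F → Linking F × All (λ p → r p ≡ 2 → Served F p) ps
    serveAll [] = proj₁ twoMatchings , proj₂ twoMatchings , []
    serveAll (p ∷ ps) with serveAll ps
    ... | F , L , served with r p ℕ.≟ 2
    ...   | no rp≢2 = F , L , (λ e → ⊥-elim (rp≢2 e)) ∷ served
    ...   | yes rp≡2 with serve p rp≡2 L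
    ...     | F′ , L′ , F⊆F′ , p-served = F′ , L′ , (λ _ → p-served) ∷
                All.map (λ s e → Served-mono F⊆F′ (s e)) served

    abstract
      F : Fin n → Sub n
      F = proj₁ (serveAll (allFin n))

      F-linking : Linking F
      F-linking = proj₁ (proj₂ (serveAll (allFin n)))

      F-served : ∀ {p} → r p ≡ 2 → Served F p
      F-served {p} = All.lookup (proj₂ (proj₂ (serveAll (allFin n)))) (∈-allFin p)

    -- The vertices that still lack an edge of H, to be supplied by V₁.
    Needy : Fin n → Set
    Needy v = (3 ≤ r v × # (F v) + E v ≤ 1) ⊎ (r v ≡ 2 × column F v ≡ 0)

    needy? : ∀ v → Dec (Needy v)
    needy? v = ((3 ≤? r v) ×-dec (# (F v) + E v ≤? 1)) ⊎-dec ((r v ℕ.≟ 2) ×-dec (column F v ℕ.≟ 0))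

    abstract
      Z : Sub n
      Z v = does (needy? v)

      Z⁻ : ∀ {v} → v ∈ Z → Needy v
      Z⁻ {v} = does⁻ (needy? v)

      Z⁺ : ∀ {v} → Needy v → v ∈ Z
      Z⁺ {v} = dec-true (needy? v)

    -- The bound forces `E v ≤ 1`, so `v` is tight and already has an edge by `row-pos`; this edge
    -- uses up the whole bound.
    needy-tight : ∀ {v} → 3 ≤ r v → # (F v) + E v ≤ 1 → Tight v × # (F v) ≡ 1 × E v ≡ 0
    needy-tight {v} 3≤r need = tight , ≤-antisym (≤-trans (m≤m+n _ _) need) row ,
        n≤0⇒n≡0 (+-cancelˡ-≤ 1 _ _ (≤-trans (+-monoˡ-≤ (E v) row) need))
      where
      tight : Tight v
      tight = 3≤r , ≤-trans (m≤n+m _ _) need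
      row : 1 ≤ # (F v)
      row = F-linking .row-pos tight

    -- Here `E u` is 0, so `u` has no higher neighbour.
    needy-top : ∀ {u v} → 3 ≤ r u → # (F u) + E u ≤ 1 → u ~ v → ¬ (r u < r v)
    needy-top {u} 3≤r need u~v u<v = <⇒≱ (#-pos {P = (adj G u ∩ Up r 3) ∩ Up r (suc (r u))} (higher∋ 3≤r u~v u<v))
      (≤-trans (higher≤E 3≤r) (≤-reflexive (proj₂ (proj₂ (needy-tight 3≤r need)))))

    -- The empty column of `p` leaves only the second case of `Served`, in which `u` has no room;
    -- but `u` has.
    unserved : ∀ {u p} → 3 ≤ r u → # (F u) + E u ≤ 1 → r p ≡ 2 → column F p ≡ 0 → ¬ (u ~ p)
    unserved 3≤r need rp≡2 col≡0 u~p with F-served rp≡2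
    ... | inj₁ pos  = <⇒≱ pos (≤-reflexive col≡0)
    ... | inj₂ full = <⇒≱ (full u~p 3≤r) (≤-trans need (s≤s z≤n))

    -- Of two adjacent needy vertices above V₂ the lower one would violate `needy-top`; mixed pairs
    -- violate `unserved`, and pairs within one layer `r-proper`.
    needy-independent : ∀ {u v} → Needy u → Needy v → ¬ (u ~ v)
    needy-independent {u} {v} (inj₁ (3≤u , nu)) (inj₁ (3≤v , nv)) u~v with <-cmp (r u) (r v)
    ... | tri< u<v _ _ = needy-top 3≤u nu u~v u<v
    ... | tri≈ _ e _   = r-proper u~v e
    ... | tri> _ _ v<u = needy-top 3≤v nv (~-sym u~v) v<u
    needy-independent (inj₁ (3≤u , nu)) (inj₂ (rv , cv)) u~v = unserved 3≤u nu rv cv u~v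
    needy-independent (inj₂ (ru , cu)) (inj₁ (3≤v , nv)) u~v = unserved 3≤v nv ru cu (~-sym u~v)
    needy-independent (inj₂ (ru , _)) (inj₂ (rv , _)) u~v = r-proper u~v (trans ru (sym rv))

    needy-rank : ∀ {v} → Needy v → 2 ≤ r v
    needy-rank (inj₁ (3≤r , _)) = <⇒≤ 3≤r
    needy-rank (inj₂ (r≡2 , _)) = ≤-reflexive (sym r≡2)

    abstract
      matchingZ : Matching Z (Layer r 1)
      matchingZ = matching (r-max (s≤s (s≤s z≤n)))
        (λ v∈ → ∧⁺ (Up⁺ r 1 (<⇒≤ (needy-rank (Z⁻ v∈)))) (not⁺ λ v∈₁ → <⇒≢ (needy-rank (Z⁻ v∈)) (sym (Layer⁻ r 1 v∈₁))))
        (λ u∈ v∈ → needy-independent (Z⁻ u∈) (Z⁻ v∈))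

    -- The graph H and its degrees

    M₁ Inner H : Fin n → Sub n
    M₁ u w = Z u ∧ ⁅ matchingZ .to u ⁆ w
    Inner u = (λ w → Up r 3 u ∧ Up r 3 w) ∩ adj G u
    -- `F` and `M₁` point from the higher layer to the lower one; the last bracket adds the reversed
    -- pairs.
    H u w  = Inner u w ∨ ((F u w ∨ M₁ u w) ∨ (F w u ∨ M₁ w u))

    M₁⁻ : ∀ {u w} → w ∈ M₁ u → u ∈ Z × w ≡ matchingZ .to u × u ~ w × 2 ≤ r u × r w ≡ 1
    M₁⁻ {u} {w} w∈ with ∧⁻ {Z u} w∈
    ... | u∈Z , w∈to with ∈⁅⁆⁻ {x = matchingZ .to u} {w} w∈to
    ...   | refl = u∈Z , refl , matchingZ .edge u∈Z , needy-rank (Z⁻ u∈Z) , Layer⁻ r 1 (matchingZ .into u∈Z)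

    Inner⁻ : ∀ {u w} → w ∈ Inner u → u ~ w × 3 ≤ r u × 3 ≤ r w
    Inner⁻ {u} {w} w∈ with ∧⁻ {Up r 3 u ∧ Up r 3 w} w∈
    ... | both , u~w with ∧⁻ {Up r 3 u} both
    ...   | u∈ , w∈′ = u~w , Up⁻ r 3 u∈ , Up⁻ r 3 w∈′

    Outer : Fin n → Sub n
    Outer u w = F u w ∨ M₁ u w

    Outer⁻ : ∀ {u w} → w ∈ Outer u → u ~ w × r w < r u × r w < 3
    Outer⁻ {u} {w} w∈ with ∨⁻ {F u w} w∈
    ... | inj₁ w∈F = case F-linking .link w∈F of λ { (u~w , 3≤r , e) →
            u~w , subst (_< r u) (sym e) 3≤r , ≤-reflexive (cong suc e) }
    ... | inj₂ w∈M = case M₁⁻ w∈M of λ { (_ , _ , u~w , 2≤r , e) →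
            u~w , subst (_< r u) (sym e) 2≤r , subst (_< 3) (sym e) (s≤s (s≤s z≤n)) }

    H-sym : ∀ u w → H u w ≡ H w u
    H-sym u w = cong₂ _∨_
      (cong₂ _∧_ (∧-comm (Up r 3 u) (Up r 3 w)) (adj-sym G u w))
      (∨-comm (Outer u w) (Outer w u))

    H⊆adj : ∀ {u} → H u ⊆ adj G u
    H⊆adj {u} {w} w∈ with ∨⁻ {Inner u w} w∈
    ... | inj₁ w∈I = proj₁ (Inner⁻ w∈I)
    ... | inj₂ w∈O with ∨⁻ {Outer u w} w∈O
    ...   | inj₁ down = proj₁ (Outer⁻ {u} {w} down)
    ...   | inj₂ up   = ~-sym (proj₁ (Outer⁻ {w} {u} up))

    M₁ᵀ : Fin n → Sub n
    M₁ᵀ v u = M₁ u v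

    -- The five parts are disjoint: inner edges have both ends in layers from 3 upwards and outer
    -- edges do not, `r` tells downward from upward edges, and `F` ends in V₂ while `M₁` ends in V₁.
    #-H : ∀ v → # (H v) ≡ # (Inner v) + ((# (F v) + # (M₁ v)) + (column F v + # (M₁ᵀ v)))
    #-H v = trans (#-∪ (Inner v) (λ w → Outer v w ∨ Outer w v) inner-outer) (cong (# (Inner v) +_)
        (trans (#-∪ (Outer v) (λ w → Outer w v) down-up) (cong₂ _+_
          (#-∪ (F v) (M₁ v) λ {p} p∈ p∈′ → 2≢1 (F-linking .link p∈) (M₁⁻ {v} {p} p∈′))
          (#-∪ (λ u → F u v) (M₁ᵀ v) λ {u} v∈ v∈′ → 2≢1 (F-linking .link v∈) (M₁⁻ {u} {v} v∈′)))))
      where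
      2≢1 : ∀ {p} {A B C D E F : Set} → A × B × r p ≡ 2 → C × D × E × F × r p ≡ 1 → ⊥
      2≢1 (_ , _ , e) (_ , _ , _ , _ , e′) with () ← trans (sym e) e′
      down-up : ∀ {w} → w ∈ Outer v → Outer w v ≢ true
      down-up {w} down up = <-asym (proj₁ (proj₂ (Outer⁻ {v} {w} down))) (proj₁ (proj₂ (Outer⁻ {w} {v} up)))
      inner-outer : ∀ {w} → w ∈ Inner v → Outer v w ∨ Outer w v ≢ true
      inner-outer {w} inner outer with Inner⁻ inner | ∨⁻ {Outer v w} outer
      ... | _ , _ , 3≤w | inj₁ down = <⇒≱ (proj₂ (proj₂ (Outer⁻ {v} {w} down))) 3≤w
      ... | _ , 3≤v , _ | inj₂ up   = <⇒≱ (proj₂ (proj₂ (Outer⁻ {w} {v} up))) 3≤v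

    #-Inner : ∀ {v} → 3 ≤ r v → # (Inner v) ≡ D v
    #-Inner {v} 3≤r = #-cong λ w → trans (cong (λ b → (b ∧ Up r 3 w) ∧ adj G v w) (Up⁺ r 3 3≤r))
                                         (∧-comm (Up r 3 w) (adj G v w))

    #-M₁ : ∀ v → # (M₁ v) ≡ 𝟙 (Z v)
    #-M₁ v with Z v
    ... | true  = #-⁅⁆ (matchingZ .to v)
    ... | false = #-∅ {n} λ _ ()

    Inner-∅ : ∀ {v} → r v < 3 → # (Inner v) ≡ 0
    Inner-∅ {v} r<3 = #-∅ {P = Inner v} λ _ w∈ → <⇒≱ r<3 (proj₁ (proj₂ (Inner⁻ w∈)))

    row-∅ : ∀ {v} → r v < 3 → # (F v) ≡ 0
    row-∅ {v} r<3 = #-∅ {P = F v} λ _ p∈ → <⇒≱ r<3 (proj₁ (proj₂ (F-linking .link p∈)))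

    column-∅ : ∀ {v} → r v ≢ 2 → column F v ≡ 0
    column-∅ {v} r≢2 = #-∅ {P = λ u → F u v} λ _ v∈ → r≢2 (proj₂ (proj₂ (F-linking .link v∈)))

    M₁-∅ : ∀ {v} → ¬ Needy v → # (M₁ v) ≡ 0
    M₁-∅ {v} v-ok = trans (#-M₁ v) (cong 𝟙 (¬-not (v-ok ∘ Z⁻)))

    M₁-one : ∀ {v} → Needy v → # (M₁ v) ≡ 1
    M₁-one {v} v-needy = trans (#-M₁ v) (cong 𝟙 (Z⁺ v-needy))

    M₁ᵀ-∅ : ∀ {v} → r v ≢ 1 → # (M₁ᵀ v) ≡ 0
    M₁ᵀ-∅ {v} r≢1 = #-∅ {P = M₁ᵀ v} λ u v∈ → r≢1 (proj₂ (proj₂ (proj₂ (proj₂ (M₁⁻ {u} {v} v∈)))))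

    M₁ᵀ≤1 : ∀ v → # (M₁ᵀ v) ≤ 1
    M₁ᵀ≤1 v = #-≤1 {P = M₁ᵀ v} λ {u} {u′} u∈ u′∈ → case M₁⁻ {u} {v} u∈ , M₁⁻ {u′} {v} u′∈ of λ
      { ((u∈Z , e , _) , (u′∈Z , e′ , _)) → matchingZ .inj u∈Z u′∈Z (trans (sym e) e′) }

    -- Exactly when this holds can a vertex label 1 or 2 raise the exponent from `d` to `r v`.
    Fits : Fin n → ℕ → Set
    Fits v d = d ≤ r v × r v ≤ suc d

    -- The degree plus 3 equals `r v + s`, so `s` must be 2 or 3. A needy vertex has
    -- `s = 1 + 0 + 1`; for any other, the lower bound is the failure of need and the upper bound is
    -- `row≤`.
    fits-upper : ∀ {v} → 3 ≤ r v → Fits v (D v + (# (F v) + # (M₁ v)))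
    fits-upper {v} 3≤r = +-cancelʳ-≤ 3 _ _ (≤-trans (≤-reflexive total) (+-monoʳ-≤ (r v) (proj₂ bounds)))
                       , +-cancelʳ-≤ 2 _ _ (≤-trans (+-monoʳ-≤ (r v) (proj₁ bounds))
                           (≤-reflexive (trans (sym total) (+-suc _ 2))))
      where
      s : ℕ
      s = # (F v) + E v + # (M₁ v)
      bounds : 2 ≤ s × s ≤ 3
      bounds with needy? v
      ... | yes (inj₂ (r≡2 , _)) = ⊥-elim (<⇒≢ 3≤r (sym r≡2))
      ... | yes need@(inj₁ (_ , few)) = ≤-reflexive (sym s≡2) , ≤-trans (≤-reflexive s≡2) (s≤s (s≤s z≤n))
        where
        s≡2 : s ≡ 2
        s≡2 = cong₂ _+_ (cong₂ _+_ (proj₁ (proj₂ (needy-tight 3≤r few))) (proj₂ (proj₂ (needy-tight 3≤r few)))) (M₁-one need)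
      ... | no ok = subst (2 ≤_) (sym s≡) (≰⇒> λ few → ok (inj₁ (3≤r , few))) ,
                    subst (_≤ 3) (sym s≡) (F-linking .row≤ 3≤r)
        where
        s≡ : s ≡ # (F v) + E v
        s≡ = trans (cong (# (F v) + E v +_) (M₁-∅ ok)) (+-identityʳ _)
      total : D v + (# (F v) + # (M₁ v)) + 3 ≡ r v + s
      total = begin
        D v + (# (F v) + # (M₁ v)) + 3   ≡⟨ solve 3 (λ d f m → d :+ (f :+ m) :+ con 3 := (d :+ con 3) :+ (f :+ m)) refl
                                              (D v) (# (F v)) (# (M₁ v)) ⟩
        D v + 3 + (# (F v) + # (M₁ v))   ≡⟨ cong (_+ (# (F v) + # (M₁ v))) (sym (E+r≡D+3 3≤r)) ⟩
        E v + r v + (# (F v) + # (M₁ v)) ≡⟨ solve 4 (λ e k f m → e :+ k :+ (f :+ m) := k :+ (f :+ e :+ m)) refl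
                                              (E v) (r v) (# (F v)) (# (M₁ v)) ⟩
        r v + s                         ∎
        where
        open ≡-Reasoning
        open +-*-Solver

    -- With an empty column `v` is needy and gets exactly one edge into V₁; otherwise the column
    -- alone gives degree 1 or 2.
    fits-second : ∀ {v} → r v ≡ 2 → Fits v (# (M₁ v) + column F v)
    fits-second {v} r≡2 with column F v in col
    ... | zero rewrite M₁-one {v} (inj₂ (r≡2 , col)) | r≡2 = s≤s z≤n , ≤-refl
    ... | suc c rewrite M₁-∅ {v} (λ { (inj₁ (3≤r , _)) → <⇒≢ 3≤r (sym r≡2)
                                    ; (inj₂ (_ , col≡0)) → case trans (sym col) col≡0 of λ () }) | r≡2 =
            subst (_≤ 2) col (F-linking .col≤2 v) , s≤s (s≤s z≤n)

    fits : ∀ v → Fits v (# (H v))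
    fits v rewrite #-H v with 3 ≤? r v
    ... | yes 3≤r rewrite #-Inner 3≤r | column-∅ {v} (λ e → <⇒≢ 3≤r (sym e))
                        | M₁ᵀ-∅ {v} (λ e → <⇒≢ (<⇒≤ 3≤r) (sym e))
                        | +-identityʳ (# (F v) + # (M₁ v)) = fits-upper 3≤r
    ... | no r<3 rewrite Inner-∅ {v} (≰⇒> r<3) | row-∅ {v} (≰⇒> r<3) with r v ℕ.≟ 2
    ...   | yes r≡2 rewrite M₁ᵀ-∅ {v} (λ e → case trans (sym r≡2) e of λ ())
                          | +-identityʳ (column F v) = fits-second r≡2
    ...   | no r≢2 rewrite column-∅ {v} r≢2 | M₁-∅ {v} (λ need → r≢2 (≤-antisym (≤-pred (≰⇒> r<3)) (needy-rank need)))
            with r v ℕ.≟ 1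
    -- On V₁ only `matchingZ` contributes, with at most one edge.
    ...     | yes r≡1 = subst (# (M₁ᵀ v) ≤_) (sym r≡1) (M₁ᵀ≤1 v) , subst (_≤ suc (# (M₁ᵀ v))) (sym r≡1) (s≤s z≤n)
    -- Only V₀ remains, where H has no edges.
    ...     | no r≢1 rewrite M₁ᵀ-∅ {v} r≢1 = z≤n , ≤-trans (≤-pred (≤∧≢⇒< (≤-pred (≰⇒> r<3)) r≢2)) ≤-refl

-- From the graph H to the labelling

-- The list `nbrs G v` filters `allFin n`, which is `tabulate id`; a general `f` lets the induction
-- on `m` go through.
product-2^ : (P b : Sub n) → b ⊆ P → ∀ {m} (f : Fin m → Fin n) →
             product (map (λ w → 2 ^ 𝟙 (b w)) (filter (λ w → P w Data.Bool.≟ true) (List.tabulate f))) ≡ 2 ^ # (b ∘ f)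
product-2^ P b b⊆P {zero}  f = refl
product-2^ P b b⊆P {suc m} f with P (f zero) in p
... | true  = trans (cong (2 ^ 𝟙 (b (f zero)) *_) (product-2^ P b b⊆P (f ∘ suc)))
                    (sym (^-distribˡ-+-* 2 (𝟙 (b (f zero))) _))
... | false with b (f zero) in q
...   | false = product-2^ P b b⊆P (f ∘ suc)
...   | true with () ← trans (sym (b⊆P q)) p

length-filter : (P : Sub n) → ∀ {m} (f : Fin m → Fin n) →
                length (filter (λ w → P w Data.Bool.≟ true) (List.tabulate f)) ≡ # (P ∘ f)
length-filter P {zero}  f = refl
length-filter P {suc m} f with P (f zero)
... | true  = cong suc (length-filter P (f ∘ suc))
... | false = length-filter P (f ∘ suc)

2^≤1 : ∀ {m} → m ≤ 1 → InRange 2 (2 ^ m)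
2^≤1 z≤n       = s≤s z≤n , s≤s z≤n
2^≤1 (s≤s z≤n) = s≤s z≤n , ≤-refl

2^-injective : ∀ {a b} → 2 ^ a ≡ 2 ^ b → a ≡ b
2^-injective {a} {b} e with <-cmp a b
... | tri< a<b _ _ = ⊥-elim (<⇒≢ (^-monoʳ-< 2 ≤-refl a<b) e)
... | tri≈ _ a≡b _ = a≡b
... | tri> _ _ b<a = ⊥-elim (<⇒≢ (^-monoʳ-< 2 ≤-refl b<a) (sym e))

T⇒≡ : ∀ {b} → T b → b ≡ true
T⇒≡ {true} _ = refl

theorem1p3 : ∀ (n : ℕ) (G : Graph n) → MaxDegree G 6 →
    ∃ (λ (ℓ : TotalLabelling n) → IsTotalLabelling G 2 ℓ × ProductProper G ℓ)
theorem1p3 n G (Δ≤6 , _) = ℓ , (vertex-range , edge-range) , proper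
  where
  r : Fin n → ℕ
  r = proj₁ (layering G 7)
  open Construction G r (proj₂ (layering G 7))
    (λ v → subst (_≤ 6) (length-filter (adj G v) id) (Δ≤6 v))
  ℓ : TotalLabelling n
  -- The vertex label supplies the factor missing from the edges, so that the product at `v` becomes
  -- `2 ^ r v`.
  ℓ .vlab v   = 2 ^ (r v ∸ # (H v))
  ℓ .elab u v = 2 ^ 𝟙 (H u v)
  vertex-range : ∀ v → InRange 2 (ℓ .vlab v)
  vertex-range v = 2^≤1 (m≤n+o⇒m∸n≤o (r v) (# (H v)) (subst (r v ≤_) (+-comm 1 _) (proj₂ (fits v))))
  edge-range : ∀ u v → T (adj G u v) → InRange 2 (ℓ .elab u v) × ℓ .elab u v ≡ ℓ .elab v u
  edge-range u v _ = 2^≤1 (𝟙≤1 (H u v)) , cong (λ b → 2 ^ 𝟙 b) (H-sym u v)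
  π≡ : ∀ v → π G ℓ v ≡ 2 ^ r v
  π≡ v = begin
    2 ^ (r v ∸ # (H v)) * product (map (ℓ .elab v) (nbrs G v))
      ≡⟨ cong (2 ^ (r v ∸ # (H v)) *_) (product-2^ (adj G v) (H v) H⊆adj id) ⟩
    2 ^ (r v ∸ # (H v)) * 2 ^ # (H v)
      ≡⟨ sym (^-distribˡ-+-* 2 (r v ∸ # (H v)) (# (H v))) ⟩
    2 ^ (r v ∸ # (H v) + # (H v))
      ≡⟨ cong (2 ^_) (m∸n+n≡m (proj₁ (fits v))) ⟩
    2 ^ r v ∎
    where open ≡-Reasoning
  proper : ProductProper G ℓ
  proper u v uv e = r-proper (T⇒≡ uv) (2^-injective (trans (sym (π≡ u)) (trans e (π≡ v))))
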